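{- (a) Let $\mathcal{L}$ be a modal logic in the language $Fm_\square$ containing $\mathit{S1SP}$. Then for any $\varphi\in Fm_\square$: $\ \vdash_{\mathcal{L}}\varphi\equiv\mathit{box}(\mathit{id}(\varphi))$. (b) Let $\mathcal{L}_\equiv$ be an axiomatic extension of $\mathit{SCI}$ in the language $Fm_\equiv$ containing as theorems all formulas of the form $(\chi\equiv\psi)\equiv\square(\chi\leftrightarrow\psi)$ (that is, $(\chi\equiv\psi)\equiv((\chi\leftrightarrow\psi)\equiv\top)$). Then for any $\varphi\in Fm_\equiv$: $\ \vdash_{\mathcal{L}_\equiv}\varphi\equiv\mathit{id}(\mathit{box}(\varphi))$.
   Context: Languages: $Fm_\equiv$ is the set of formulas built from variables $V=\{x_0,x_1,\dots\}$, $\bot,\top,\neg,\vee,\wedge,\rightarrow$ and a binary connective $\equiv$. $Fm_\square$ is built from the same variables and classical connectives and a unary operator $\square$. $\varphi\leftrightarrow\psi$ abbreviates $(\varphi\rightarrow\psi)\wedge(\psi\rightarrow\varphi)$. In $Fm_\equiv$, $\square\varphi$ abbreviates $\varphi\equiv\top$. In $Fm_\square$, $\varphi\equiv\psi$ abbreviates $\square(\varphi\leftrightarrow\psi)$. $\mathit{SCI}$ (in $Fm_\equiv$): axioms are all substitution instances of classical tautologies and all formulas $\varphi\equiv\varphi$; $(\varphi\equiv\psi)\rightarrow(\varphi\rightarrow\psi)$; $(\varphi\equiv\psi)\rightarrow(\neg\varphi\equiv\neg\psi)$; $((\varphi_1\equiv\psi_1)\wedge(\varphi_2\equiv\psi_2))\rightarrow((\varphi_1*\varphi_2)\equiv(\psi_1*\psi_2))$,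 $*\in\{\vee,\wedge,\rightarrow,\equiv\}$; rule Modus Ponens (MP). An axiomatic extension of $\mathit{SCI}$ adds further formulas as axioms/theorems, with MP as rule. $\mathit{S1SP}$ (in $Fm_\square$): axioms are all substitution instances of classical tautologies, $\square\varphi\rightarrow\varphi$, and $(\square(\varphi\rightarrow\psi)\wedge\square(\psi\rightarrow\chi))\rightarrow\square(\varphi\rightarrow\chi)$; theorems are generated from these axioms, from $\square\varphi$ for each axiom $\varphi$ (Axiom Necessitation), and from all instances of the Substitution Principle SP, $(\varphi\equiv\psi)\rightarrow(\chi[x:=\varphi]\equiv\chi[x:=\psi])$ (to which Axiom Necessitation is not applied), by MP. A modal logic containing $\mathit{S1SP}$ is one whose theorems include those of $\mathit{S1SP}$ and are closed under MP. Translations: $\mathit{box}\colon Fm_\equiv\to Fm_\square$ is the identity on variables, $\bot$, $\top$, commutes with $\neg,\wedge,\vee,\rightarrow$, and $\mathit{box}(\varphi\equiv\psi):=\square(\mathit{box}(\varphi)\leftrightarrow\mathit{box}(\psi))$. $\mathit{id}\colon Fm_\square\to Fm_\equiv$ is the identity on variables, $\bot$, $\top$, commutes with $\neg,\wedge,\vee,\rightarrow$, and $\mathit{id}(\square\varphi):=(\mathit{id}(\varphi)\equiv\top)$. -}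

module Defs where

open import Data.Bool.Base as Bool using (Bool; true; false; if_then_else_)
open import Data.Nat.Base using (ℕ)
open import Data.Nat.Properties using (_≟_)
open import Level using (Level)
open import Relation.Binary.PropositionalEquality using (_≡_)
open import Relation.Nullary.Decidable using (does)
open import Relation.Unary using (Pred)

infix  9 _[_:=_]
infix  8 ¬_ □_ □ₛ_
infixr 7 _∧_
infixr 6 _∨_
infixr 5 _⇒_
infix  4 _⇔ₛ_ _⇔_
infix  3 _≡ₛ_ _≡□_
infix  2 _⊢SCI_ ⊢S1SP_

data PropFm : Set where
  var         : ℕ → PropFm
  ⊥ ⊤         : PropFm
  ¬_          : PropFm → PropFm
  _∨_ _∧_ _⇒_ : PropFm → PropFm → PropFm

eval : (ℕ → Bool) → PropFm → Bool
eval v (var x) = v x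
eval v ⊥       = false
eval v ⊤       = true
eval v (¬ p)   = Bool.not (eval v p)
eval v (p ∨ q) = eval v p Bool.∨ eval v q
eval v (p ∧ q) = eval v p Bool.∧ eval v q
eval v (p ⇒ q) = Bool.not (eval v p) Bool.∨ eval v q

Tautology : PropFm → Set
Tautology p = ∀ v → eval v p ≡ true

-- _≡ₛ_ is the identity connective of SCI; _≡_ is Agda's propositional equality.

data Fm≡ : Set where
  var              : ℕ → Fm≡
  ⊥ ⊤              : Fm≡
  ¬_               : Fm≡ → Fm≡
  _∨_ _∧_ _⇒_ _≡ₛ_ : Fm≡ → Fm≡ → Fm≡

_⇔ₛ_ : Fm≡ → Fm≡ → Fm≡
φ ⇔ₛ ψ = (φ ⇒ ψ) ∧ (ψ ⇒ φ)

□ₛ_ : Fm≡ → Fm≡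
□ₛ φ = φ ≡ₛ ⊤

inst≡ : (ℕ → Fm≡) → PropFm → Fm≡
inst≡ σ (var x) = σ x
inst≡ σ ⊥       = ⊥
inst≡ σ ⊤       = ⊤
inst≡ σ (¬ p)   = ¬ inst≡ σ p
inst≡ σ (p ∨ q) = inst≡ σ p ∨ inst≡ σ q
inst≡ σ (p ∧ q) = inst≡ σ p ∧ inst≡ σ q
inst≡ σ (p ⇒ q) = inst≡ σ p ⇒ inst≡ σ q

data Fm□ : Set where
  var         : ℕ → Fm□
  ⊥ ⊤         : Fm□
  ¬_ □_       : Fm□ → Fm□
  _∨_ _∧_ _⇒_ : Fm□ → Fm□ → Fm□

_⇔_ : Fm□ → Fm□ → Fm□
φ ⇔ ψ = (φ ⇒ ψ) ∧ (ψ ⇒ φ)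

_≡□_ : Fm□ → Fm□ → Fm□
φ ≡□ ψ = □ (φ ⇔ ψ)

inst□ : (ℕ → Fm□) → PropFm → Fm□
inst□ σ (var x) = σ x
inst□ σ ⊥       = ⊥
inst□ σ ⊤       = ⊤
inst□ σ (¬ p)   = ¬ inst□ σ p
inst□ σ (p ∨ q) = inst□ σ p ∨ inst□ σ q
inst□ σ (p ∧ q) = inst□ σ p ∧ inst□ σ q
inst□ σ (p ⇒ q) = inst□ σ p ⇒ inst□ σ q

_[_:=_] : Fm□ → ℕ → Fm□ → Fm□
var y   [ x := φ ] = if does (x ≟ y) then φ else var y
⊥       [ x := φ ] = ⊥
⊤       [ x := φ ] = ⊤
(¬ χ)   [ x := φ ] = ¬ (χ [ x := φ ])
(□ χ)   [ x := φ ] = □ (χ [ x := φ ])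
(χ ∨ ψ) [ x := φ ] = (χ [ x := φ ]) ∨ (ψ [ x := φ ])
(χ ∧ ψ) [ x := φ ] = (χ [ x := φ ]) ∧ (ψ [ x := φ ])
(χ ⇒ ψ) [ x := φ ] = (χ [ x := φ ]) ⇒ (ψ [ x := φ ])

data SCIAxiom : Fm≡ → Set where
  taut   : ∀ p → Tautology p → ∀ σ → SCIAxiom (inst≡ σ p)
  ≡-refl : ∀ φ → SCIAxiom (φ ≡ₛ φ)
  ≡-elim : ∀ φ ψ → SCIAxiom ((φ ≡ₛ ψ) ⇒ (φ ⇒ ψ))
  ¬-cong : ∀ φ ψ → SCIAxiom ((φ ≡ₛ ψ) ⇒ ((¬ φ) ≡ₛ (¬ ψ)))
  ∨-cong : ∀ φ₁ ψ₁ φ₂ ψ₂ →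
           SCIAxiom (((φ₁ ≡ₛ ψ₁) ∧ (φ₂ ≡ₛ ψ₂)) ⇒ ((φ₁ ∨ φ₂) ≡ₛ (ψ₁ ∨ ψ₂)))
  ∧-cong : ∀ φ₁ ψ₁ φ₂ ψ₂ →
           SCIAxiom (((φ₁ ≡ₛ ψ₁) ∧ (φ₂ ≡ₛ ψ₂)) ⇒ ((φ₁ ∧ φ₂) ≡ₛ (ψ₁ ∧ ψ₂)))
  ⇒-cong : ∀ φ₁ ψ₁ φ₂ ψ₂ →
           SCIAxiom (((φ₁ ≡ₛ ψ₁) ∧ (φ₂ ≡ₛ ψ₂)) ⇒ ((φ₁ ⇒ φ₂) ≡ₛ (ψ₁ ⇒ ψ₂)))
  ≡-cong : ∀ φ₁ ψ₁ φ₂ ψ₂ →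
           SCIAxiom (((φ₁ ≡ₛ ψ₁) ∧ (φ₂ ≡ₛ ψ₂)) ⇒ ((φ₁ ≡ₛ φ₂) ≡ₛ (ψ₁ ≡ₛ ψ₂)))

-- Ax ⊢SCI φ : φ is a theorem of the axiomatic extension of SCI by the
-- formulas in Ax.

data _⊢SCI_ {ℓ : Level} (Ax : Pred Fm≡ ℓ) : Fm≡ → Set ℓ where
  axiom : ∀ {φ} → SCIAxiom φ → Ax ⊢SCI φ
  extra : ∀ {φ} → Ax φ → Ax ⊢SCI φ
  mp    : ∀ {φ ψ} → Ax ⊢SCI (φ ⇒ ψ) → Ax ⊢SCI φ → Ax ⊢SCI ψ

-- The axioms subject to Axiom Necessitation, hence without SP.

data S1Axiom : Fm□ → Set where
  taut    : ∀ p → Tautology p → ∀ σ → S1Axiom (inst□ σ p)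
  □-elim  : ∀ φ → S1Axiom ((□ φ) ⇒ φ)
  □-trans : ∀ φ ψ χ → S1Axiom (((□ (φ ⇒ ψ)) ∧ (□ (ψ ⇒ χ))) ⇒ (□ (φ ⇒ χ)))

data ⊢S1SP_ : Fm□ → Set where
  axiom : ∀ {φ} → S1Axiom φ → ⊢S1SP φ
  nec   : ∀ {φ} → S1Axiom φ → ⊢S1SP (□ φ)
  sp    : ∀ φ ψ χ x → ⊢S1SP ((φ ≡□ ψ) ⇒ (χ [ x := φ ] ≡□ χ [ x := ψ ]))
  mp    : ∀ {φ ψ} → ⊢S1SP (φ ⇒ ψ) → ⊢S1SP φ → ⊢S1SP ψ

-- A modal logic is identified with its set of theorems.

record IsModalLogic⊇S1SP {ℓ : Level} (L : Pred Fm□ ℓ) : Set ℓ where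
  field
    ⊇S1SP     : ∀ {φ} → ⊢S1SP φ → L φ
    closed-mp : ∀ {φ ψ} → L (φ ⇒ ψ) → L φ → L ψ

box : Fm≡ → Fm□
box (var x)  = var x
box ⊥        = ⊥
box ⊤        = ⊤
box (¬ φ)    = ¬ box φ
box (φ ∨ ψ)  = box φ ∨ box ψ
box (φ ∧ ψ)  = box φ ∧ box ψ
box (φ ⇒ ψ)  = box φ ⇒ box ψ
box (φ ≡ₛ ψ) = □ (box φ ⇔ box ψ)

id : Fm□ → Fm≡
id (var x) = var x
id ⊥       = ⊥
id ⊤       = ⊤
id (¬ φ)   = ¬ id φ
id (□ φ)   = id φ ≡ₛ ⊤
id (φ ∨ ψ) = id φ ∨ id ψ
id (φ ∧ ψ) = id φ ∧ id ψ
id (φ ⇒ ψ) = id φ ⇒ id ψ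

{-# OPTIONS --safe #-}

-- In both logics the relation "⊢ φ ≡ ψ" is a congruence for all connectives, so
-- each part follows by induction on φ.  Only the case of the operator that is
-- translated non-trivially needs more: ⊢ □φ ≡ □(φ ↔ ⊤), which is SP applied to
-- the necessitated tautology φ ↔ (φ ↔ ⊤), in (a), and the schema assumed of the
-- extension in (b).

module Submission where

open import Defs
open import Data.Bool.Base using (true; false; if_then_else_)
open import Data.Nat.Base using (ℕ; zero; suc; _⊔_; _≤_)
open import Data.Nat.Properties using (_≟_; ≤-refl; <⇒≢; m⊔n≤o⇒m≤o; m⊔n≤o⇒n≤o)
open import Data.Product using (_×_; _,_)
open import Function.Base using (_∘_)
open import Level using (Level)
open import Relation.Binary.PropositionalEquality
  using (_≡_; refl; sym; trans; cong; cong₂; subst₂)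
open import Relation.Nullary.Decidable using (dec-true; dec-false)
open import Relation.Unary using (Pred)

private
  variable
    ℓ : Level

-- A strict bound: the number `varBound φ` is itself a variable that does not occur in `φ`, so it
-- can mark a hole in a context for SP.
varBound : Fm□ → ℕ
varBound (var x) = suc x
varBound ⊥       = zero
varBound ⊤       = zero
varBound (¬ φ)   = varBound φ
varBound (□ φ)   = varBound φ
varBound (φ ∨ ψ) = varBound φ ⊔ varBound ψ
varBound (φ ∧ ψ) = varBound φ ⊔ varBound ψ
varBound (φ ⇒ ψ) = varBound φ ⊔ varBound ψ

var-[:=] : ∀ x φ → var x [ x := φ ] ≡ φ
var-[:=] x φ = cong (if_then φ else var x) (dec-true (x ≟ x) refl)

fresh-[:=] : ∀ χ x φ → varBound χ ≤ x → χ [ x := φ ] ≡ χ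
-- Here `b` reads `suc y ≤ x`, that is `y < x`, so the comparison in the substitution comes out
-- false.
fresh-[:=] (var y) x φ b =
  cong (if_then φ else var y) (dec-false (x ≟ y) (<⇒≢ b ∘ sym))
fresh-[:=] ⊥       x φ b = refl
fresh-[:=] ⊤       x φ b = refl
fresh-[:=] (¬ χ)   x φ b = cong ¬_ (fresh-[:=] χ x φ b)
fresh-[:=] (□ χ)   x φ b = cong □_ (fresh-[:=] χ x φ b)
fresh-[:=] (χ ∨ ψ) x φ b =
  cong₂ _∨_ (fresh-[:=] χ x φ (m⊔n≤o⇒m≤o _ _ b)) (fresh-[:=] ψ x φ (m⊔n≤o⇒n≤o _ _ b))
fresh-[:=] (χ ∧ ψ) x φ b =
  cong₂ _∧_ (fresh-[:=] χ x φ (m⊔n≤o⇒m≤o _ _ b)) (fresh-[:=] ψ x φ (m⊔n≤o⇒n≤o _ _ b))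
fresh-[:=] (χ ⇒ ψ) x φ b =
  cong₂ _⇒_ (fresh-[:=] χ x φ (m⊔n≤o⇒m≤o _ _ b)) (fresh-[:=] ψ x φ (m⊔n≤o⇒n≤o _ _ b))

-- Biconditionals are spelled out as `_⇔_` unfolds, so that instances reduce to the intended
-- formulas.
⇔-refl ⇔-elim ⇔-⊤ ∧-pair : PropFm
⇔-refl = (var 0 ⇒ var 0) ∧ (var 0 ⇒ var 0)
⇔-elim = ((var 0 ⇒ var 1) ∧ (var 1 ⇒ var 0)) ⇒ (var 0 ⇒ var 1)
⇔-⊤    = (var 0 ⇒ ((var 0 ⇒ ⊤) ∧ (⊤ ⇒ var 0))) ∧
         (((var 0 ⇒ ⊤) ∧ (⊤ ⇒ var 0)) ⇒ var 0)
∧-pair = var 0 ⇒ (var 1 ⇒ (var 0 ∧ var 1))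

⇔-refl-tautology : Tautology ⇔-refl
⇔-refl-tautology v with v 0
... | true  = refl
... | false = refl

⇔-elim-tautology : Tautology ⇔-elim
⇔-elim-tautology v with v 0 | v 1
... | true  | true  = refl
... | true  | false = refl
... | false | true  = refl
... | false | false = refl

⇔-⊤-tautology : Tautology ⇔-⊤
⇔-⊤-tautology v with v 0
... | true  = refl
... | false = refl

∧-pair-tautology : Tautology ∧-pair
∧-pair-tautology v with v 0 | v 1
... | true  | true  = refl
... | true  | false = refl
... | false | true  = refl
... | false | false = refl

assign : {A : Set} → A → A → ℕ → A
assign φ ψ zero    = φ
assign φ ψ (suc _) = ψ

≡□-refl : ∀ φ → ⊢S1SP (φ ≡□ φ)
≡□-refl φ = nec (taut ⇔-refl ⇔-refl-tautology (assign φ φ))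

≡□-mp : ∀ {φ ψ} → ⊢S1SP (φ ≡□ ψ) → ⊢S1SP φ → ⊢S1SP ψ
≡□-mp {φ} {ψ} φ≡ψ =
  mp (mp (axiom (taut ⇔-elim ⇔-elim-tautology (assign φ ψ))) (mp (axiom (□-elim _)) φ≡ψ))

-- SP with `χ` as context and `x` as its hole. The two equations absorb substitutions that do not
-- compute when `x` is a fresh variable depending on a formula.
≡□-replace : ∀ χ x {φ ψ φ′ ψ′} → χ [ x := φ ] ≡ φ′ → χ [ x := ψ ] ≡ ψ′ →
             ⊢S1SP (φ ≡□ ψ) → ⊢S1SP (φ′ ≡□ ψ′)
≡□-replace χ x eq eq′ φ≡ψ =
  subst₂ (λ α β → ⊢S1SP (α ≡□ β)) eq eq′ (mp (sp _ _ χ x) φ≡ψ)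

-- Replacing `ψ` by `χ` in the context `φ ≡□ var x`, with `x` fresh for `φ`, identifies the first
-- premise with the conclusion.
≡□-trans : ∀ {φ ψ χ} → ⊢S1SP (φ ≡□ ψ) → ⊢S1SP (ψ ≡□ χ) → ⊢S1SP (φ ≡□ χ)
≡□-trans {φ} {ψ} {χ} φ≡ψ ψ≡χ = ≡□-mp (≡□-replace (φ ≡□ var x) x (plug ψ) (plug χ) ψ≡χ) φ≡ψ
  where
  x = varBound φ
  plug : ∀ α → (φ ≡□ var x) [ x := α ] ≡ (φ ≡□ α)
  plug α = cong₂ _≡□_ (fresh-[:=] φ x α ≤-refl) (var-[:=] x α)

-- SP changes one argument at a time, passing through `φ′ * ψ`; each hole is fresh for the argument
-- held fixed.
≡□-cong₂ : (_*_ : Fm□ → Fm□ → Fm□) →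
           (∀ χ ψ x φ → (χ * ψ) [ x := φ ] ≡ ((χ [ x := φ ]) * (ψ [ x := φ ]))) →
           ∀ {φ φ′ ψ ψ′} → ⊢S1SP (φ ≡□ φ′) → ⊢S1SP (ψ ≡□ ψ′) →
           ⊢S1SP ((φ * ψ) ≡□ (φ′ * ψ′))
≡□-cong₂ _*_ *-[:=] {φ} {φ′} {ψ} {ψ′} φ≡φ′ ψ≡ψ′ =
  ≡□-trans (≡□-replace (var x * ψ) x (plugˡ φ) (plugˡ φ′) φ≡φ′)
           (≡□-replace (φ′ * var y) y (plugʳ ψ) (plugʳ ψ′) ψ≡ψ′)
  where
  x = varBound ψ
  y = varBound φ′
  plugˡ : ∀ α → (var x * ψ) [ x := α ] ≡ (α * ψ)
  plugˡ α = trans (*-[:=] (var x) ψ x α)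
                  (cong₂ _*_ (var-[:=] x α) (fresh-[:=] ψ x α ≤-refl))
  plugʳ : ∀ α → (φ′ * var y) [ y := α ] ≡ (φ′ * α)
  plugʳ α = trans (*-[:=] φ′ (var y) y α)
                  (cong₂ _*_ (fresh-[:=] φ′ y α ≤-refl) (var-[:=] y α))

≡□-□-cong : ∀ {φ ψ} → ⊢S1SP (φ ≡□ ψ) → ⊢S1SP ((□ φ) ≡□ (□ ψ))
-- The context has no other variable, so the numeral `0` serves as the hole and both substitutions
-- compute.
≡□-□-cong = ≡□-replace (□ var 0) 0 refl refl

□≡□⇔⊤ : ∀ φ → ⊢S1SP ((□ φ) ≡□ (□ (φ ⇔ ⊤)))
□≡□⇔⊤ φ = ≡□-□-cong (nec (taut ⇔-⊤ ⇔-⊤-tautology (assign φ φ)))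

-- The induction stays inside `S1SP`; any logic containing it inherits the result by inclusion.
≡□-box-id : ∀ φ → ⊢S1SP (φ ≡□ box (id φ))
≡□-box-id (var x) = ≡□-refl (var x)
≡□-box-id ⊥       = ≡□-refl ⊥
≡□-box-id ⊤       = ≡□-refl ⊤
≡□-box-id (¬ φ)   = ≡□-replace (¬ var 0) 0 refl refl (≡□-box-id φ)
≡□-box-id (□ φ)   = ≡□-trans (≡□-□-cong (≡□-box-id φ)) (□≡□⇔⊤ (box (id φ)))
≡□-box-id (φ ∨ ψ) = ≡□-cong₂ _∨_ (λ _ _ _ _ → refl) (≡□-box-id φ) (≡□-box-id ψ)
≡□-box-id (φ ∧ ψ) = ≡□-cong₂ _∧_ (λ _ _ _ _ → refl) (≡□-box-id φ) (≡□-box-id ψ)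
≡□-box-id (φ ⇒ ψ) = ≡□-cong₂ _⇒_ (λ _ _ _ _ → refl) (≡□-box-id φ) (≡□-box-id ψ)

module _ {Ax : Pred Fm≡ ℓ} where

  ∧-intro : ∀ {φ ψ} → Ax ⊢SCI φ → Ax ⊢SCI ψ → Ax ⊢SCI (φ ∧ ψ)
  ∧-intro {φ} {ψ} p q =
    mp (mp (axiom (taut ∧-pair ∧-pair-tautology (assign φ ψ))) p) q

  -- From `φ ≡ₛ φ` and `ψ ≡ₛ χ`, `≡-cong` yields `(φ ≡ₛ ψ) ≡ₛ (φ ≡ₛ χ)`, which `≡-elim` turns into
  -- an implication.
  ≡ₛ-trans : ∀ {φ ψ χ} → Ax ⊢SCI (φ ≡ₛ ψ) → Ax ⊢SCI (ψ ≡ₛ χ) → Ax ⊢SCI (φ ≡ₛ χ)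
  ≡ₛ-trans φ≡ψ ψ≡χ =
    mp (mp (axiom (≡-elim _ _))
           (mp (axiom (≡-cong _ _ _ _)) (∧-intro (axiom (≡-refl _)) ψ≡χ)))
       φ≡ψ

  ≡ₛ-id-box : (∀ χ ψ → Ax ⊢SCI ((χ ≡ₛ ψ) ≡ₛ (□ₛ (χ ⇔ₛ ψ)))) →
              ∀ φ → Ax ⊢SCI (φ ≡ₛ id (box φ))
  ≡ₛ-id-box ≡≡□⇔ = go
    where
    go : ∀ φ → Ax ⊢SCI (φ ≡ₛ id (box φ))
    go (var x)  = axiom (≡-refl _)
    go ⊥        = axiom (≡-refl _)
    go ⊤        = axiom (≡-refl _)
    go (¬ φ)    = mp (axiom (¬-cong _ _)) (go φ)
    go (φ ∨ ψ)  = mp (axiom (∨-cong _ _ _ _)) (∧-intro (go φ) (go ψ))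
    go (φ ∧ ψ)  = mp (axiom (∧-cong _ _ _ _)) (∧-intro (go φ) (go ψ))
    go (φ ⇒ ψ)  = mp (axiom (⇒-cong _ _ _ _)) (∧-intro (go φ) (go ψ))
    -- `id (box (φ ≡ₛ ψ))` computes to `□ₛ (id (box φ) ⇔ₛ id (box ψ))`, so the schema is taken at
    -- the translated arguments.
    go (φ ≡ₛ ψ) =
      ≡ₛ-trans (mp (axiom (≡-cong _ _ _ _)) (∧-intro (go φ) (go ψ))) (≡≡□⇔ _ _)

theorem5p2 : (ℓ₁ ℓ₂ : Level) →
    ((L : Pred Fm□ ℓ₁) → IsModalLogic⊇S1SP L →
    (φ : Fm□) → L (φ ≡□ box (id φ)))
    ×
    ((Ax : Pred Fm≡ ℓ₂) →
    ((χ ψ : Fm≡) → Ax ⊢SCI ((χ ≡ₛ ψ) ≡ₛ (□ₛ (χ ⇔ₛ ψ)))) →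
    (φ : Fm≡) → Ax ⊢SCI (φ ≡ₛ id (box φ)))
theorem5p2 ℓ₁ ℓ₂ =
  (λ L logic φ → IsModalLogic⊇S1SP.⊇S1SP logic (≡□-box-id φ)) ,
  (λ Ax → ≡ₛ-id-box)
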